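{- Let $c,d\in\mathbb{Z}$. For any prime $p>3$, we have $$\det[(i^2+cij+dj^2)^{p-2}]_{0\le i,j\le p-1}\equiv 0\pmod p.$$
   Context: $[a_{ij}]_{0\le i,j\le p-1}$ denotes the $p\times p$ integer matrix with rows and columns indexed by $0,1,\ldots,p-1$ whose $(i,j)$ entry is $a_{ij}$. -}

module Defs where

open import Data.Fin.Base using (Fin; zero; suc; toℕ; punchIn)
open import Data.Integer.Base using (ℤ; +_; 1ℤ; -1ℤ; _-_; _*_; _^_)
open import Data.Integer.Divisibility.Signed using (_∣_)
open import Data.Integer.Properties using (+-0-commutativeMonoid)
open import Data.Nat.Base as ℕ using (ℕ)
open import Algebra.Properties.CommutativeMonoid.Sum +-0-commutativeMonoid using (sum)

Matrix : ℕ → Set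
Matrix n = Fin n → Fin n → ℤ

minor : ∀ {n} → Fin (ℕ.suc n) → Matrix (ℕ.suc n) → Matrix n
minor k A i j = A (suc i) (punchIn k j)

-- Laplace expansion along row 0.  Columns are counted from 0, so the sign of
-- column k is (-1)^k; the 0×0 determinant is 1.
det : ∀ {n} → Matrix n → ℤ
det {ℕ.zero}  A = 1ℤ
det {ℕ.suc n} A = sum (λ k → -1ℤ ^ toℕ k * A zero k * det (minor k A))

infix 4 _≡_[mod_]

_≡_[mod_] : ℤ → ℤ → ℕ → Set
a ≡ b [mod m ] = + m ∣ a - b

{-# OPTIONS --safe #-}
module Submission where

open import Defs
open import Data.Integer.Base using (ℤ; 0ℤ; 1ℤ; -1ℤ; +_; _+_; _*_; _^_; -_; _-_) renaming (∣_∣ to abs)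
open import Data.Integer.Properties using (
  +-0-commutativeMonoid; *-1-commutativeMonoid; +-*-semiring;
  +-assoc; +-comm; +-identityʳ; *-zeroʳ; *-identityˡ; *-assoc; *-comm; ^-*-assoc; pos-*;
  abs-*; ∣m⊝n∣≤m⊔n; m-n≡m⊖n; ∣i∣≡0⇒i≡0; i-j≡0⇒i≡j; i≡j⇒i-j≡0; +-injective)
open import Data.Integer.DivMod using (_%ℕ_; _/ℕ_; n%ℕd<d; a≡a%ℕn+[a/ℕn]*n)
open import Data.Integer.Divisibility.Signed
open import Data.Integer.Tactic.RingSolver using (solve-∀)
open import Data.Fin.Base using (Fin; zero; suc; toℕ; fromℕ<; inject₁; punchIn; punchOut) renaming (_<_ to _<ᶠ_)
open import Data.Fin.Properties using (_≟_; <-cmp; suc-injective; toℕ-injective; toℕ<n; toℕ-fromℕ<; toℕ-inject₁;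
  punchInᵢ≢i; punchIn-injective; punchIn-punchOut)
open import Data.Fin.Induction using (<-weakInduction)
open import Data.Fin.Permutation using (Permutation′; permutation; _⟨$⟩ʳ_)
open import Data.Nat.Base as ℕ using (ℕ; zero; suc; NonZero; _<_; _∸_; s≤s; s≤s⁻¹)
import Data.Nat.Properties as ℕ
import Data.Nat.Divisibility as ℕ
open import Data.Nat.Coprimality using (prime⇒coprime; coprime-Bézout)
open import Data.Nat.GCD using (module Bézout)
open import Data.Nat.Primality using (Prime; euclidsLemma; prime⇒nonTrivial)
open import Data.Product.Base as Product using (∃-syntax; _×_; _,_)
open import Data.Sum.Base as Sum using (_⊎_; inj₁; inj₂)
open import Data.Vec.Functional using (Vector; updateAt)
open import Data.Vec.Functional.Properties using (updateAt-updates; updateAt-minimal; updateAt-id-local)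
open import Function.Base using (const; _∘_)
open import Relation.Binary.Bundles using (Setoid)
open import Relation.Binary.Definitions using (tri<; tri≈; tri>)
import Relation.Binary.Reasoning.Setoid as SetoidReasoning
open import Relation.Binary.PropositionalEquality
open import Relation.Nullary using (¬_; yes; no; contradiction)
open import Algebra.Properties.CommutativeMonoid.Sum +-0-commutativeMonoid
  using (sum; sum-cong-≗; ∑-distrib-+; sum-remove; sum-replicate-zero; sum-permute)
open import Algebra.Properties.CommutativeMonoid.Sum *-1-commutativeMonoid
  using () renaming (sum to product; ∑-distrib-+ to ∏-distrib-*; sum-permute to product-permute)
open import Algebra.Properties.Semiring.Sum +-*-semiring using (*-distribˡ-sum)

-- Write f(x,y) = x² + c x y + d y².  For i ≢ 0, substituting j = i t gives
-- Σⱼ f(i,j)^(p-2) ≡ i^(2(p-2)) Σₜ f(1,t)^(p-2) = C f(i,0)^(p-2), with C independent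
-- of i.  For i = 0 both sides vanish, since Σⱼ j^(2(p-2)) ≡ 0 when p > 3.  So the sum
-- of all columns is congruent to C times column 0, a relation in which column 1
-- has coefficient 1, and by Cramer's rule p divides the determinant.

private variable
  m n : ℕ
  a b a′ b′ : ℤ

-- Determinants

module _ where

  open ≡-Reasoning

  det-cong : {A B : Matrix n} → (∀ i j → A i j ≡ B i j) → det A ≡ det B
  det-cong {zero}  A≗B = refl
  det-cong {suc n} A≗B = sum-cong-≗ λ k →
    cong₂ (λ a d → -1ℤ ^ toℕ k * a * d) (A≗B zero k) (det-cong λ i j → A≗B (suc i) (punchIn k j))

  AgreeOff : Fin n → Matrix n → Matrix n → Set
  AgreeOff k A B = ∀ i j → j ≢ k → A i j ≡ B i j

  minor-agree : {A B : Matrix (suc n)} (k : Fin (suc n)) → AgreeOff k A B →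
                det (minor k A) ≡ det (minor k B)
  minor-agree k A~B = det-cong λ i j → A~B (suc i) (punchIn k j) (punchInᵢ≢i k j)

  -- After column `l` is deleted, the old column `k` stands at position `punchOut l≢k`.
  minor-agreeOff : {A B : Matrix (suc n)} {k l : Fin (suc n)} (l≢k : l ≢ k) →
                   AgreeOff k A B → AgreeOff (punchOut l≢k) (minor l A) (minor l B)
  minor-agreeOff {l = l} l≢k A~B i j j≢ = A~B (suc i) (punchIn l j) λ eq →
    j≢ (punchIn-injective l j _ (trans eq (sym (punchIn-punchOut l≢k))))

  -- Three matrices related by hypotheses, rather than one matrix with a replaced column, let the
  -- induction pass directly to minors. In the Laplace term of column `k` the entry splits and the
  -- minors agree; in every other term the entries agree and the minor splits by induction.
  det-linear : (A B C : Matrix n) (k : Fin n) (x : ℤ) →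
               (∀ i → A i k ≡ B i k + x * C i k) → AgreeOff k A B → AgreeOff k A C →
               det A ≡ det B + x * det C
  det-linear {suc n} A B C k x Aₖ A~B A~C = begin
    sum (term A)                              ≡⟨ sum-cong-≗ term-linear ⟩
    sum (λ l → term B l + x * term C l)       ≡⟨ ∑-distrib-+ (term B) (λ l → x * term C l) ⟩
    sum (term B) + sum (λ l → x * term C l)   ≡⟨ cong (λ s → det B + s) (*-distribˡ-sum x (term C)) ⟨
    sum (term B) + x * sum (term C)           ∎
    where
    term : Matrix (suc n) → Fin (suc n) → ℤ
    term M l = -1ℤ ^ toℕ l * M zero l * det (minor l M)

    expand-entry : ∀ s b x c d → s * (b + x * c) * d ≡ s * b * d + x * (s * c * d)
    expand-entry = solve-∀

    expand-minor : ∀ s a x d e → s * a * (d + x * e) ≡ s * a * d + x * (s * a * e)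
    expand-minor = solve-∀

    term-linear : ∀ l → term A l ≡ term B l + x * term C l
    term-linear l with l ≟ k
    ... | yes refl = begin
      s * A zero l * det (minor l A)
        ≡⟨ cong (λ a → s * a * det (minor l A)) (Aₖ zero) ⟩
      s * (B zero l + x * C zero l) * det (minor l A)
        ≡⟨ expand-entry s (B zero l) x (C zero l) _ ⟩
      s * B zero l * det (minor l A) + x * (s * C zero l * det (minor l A))
        ≡⟨ cong₂ (λ d e → s * B zero l * d + x * (s * C zero l * e))
                 (minor-agree l A~B) (minor-agree l A~C) ⟩
      term B l + x * term C l ∎
      where s = -1ℤ ^ toℕ l
    ... | no l≢k = begin
      s * A zero l * det (minor l A)
        ≡⟨ cong (s * A zero l *_) (det-linear (minor l A) (minor l B) (minor l C) (punchOut l≢k) x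
             (λ i → subst (λ j → A (suc i) j ≡ B (suc i) j + x * C (suc i) j)
                          (sym (punchIn-punchOut l≢k)) (Aₖ (suc i)))
             (minor-agreeOff l≢k A~B) (minor-agreeOff l≢k A~C)) ⟩
      s * A zero l * (det (minor l B) + x * det (minor l C))
        ≡⟨ expand-minor s (A zero l) x _ _ ⟩
      s * A zero l * det (minor l B) + x * (s * A zero l * det (minor l C))
        ≡⟨ cong₂ (λ b c → s * b * det (minor l B) + x * (s * c * det (minor l C)))
                 (A~B zero l l≢k) (A~C zero l l≢k) ⟩
      term B l + x * term C l ∎
      where s = -1ℤ ^ toℕ l

  -- Vanishing for two equal adjacent columns

  sum-adjacent-cancel : (f : Vector ℤ (suc n)) (k : Fin n) →
                        (∀ l → l ≢ inject₁ k → l ≢ suc k → f l ≡ 0ℤ) →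
                        f (inject₁ k) + f (suc k) ≡ 0ℤ → sum f ≡ 0ℤ
  sum-adjacent-cancel {suc n} f zero f≗0 cancel = begin
    f zero + (f (suc zero) + sum rest) ≡⟨ +-assoc (f zero) _ _ ⟨
    f zero + f (suc zero) + sum rest   ≡⟨ cong₂ _+_ cancel
      (trans (sum-cong-≗ λ l → f≗0 (suc (suc l)) (λ ()) (λ ())) (sum-replicate-zero n)) ⟩
    0ℤ ∎
    where rest = λ l → f (suc (suc l))
  sum-adjacent-cancel f (suc k) f≗0 cancel =
    cong₂ _+_ (f≗0 zero (λ ()) (λ ()))
      (sum-adjacent-cancel (λ l → f (suc l)) k
        (λ l l≢ l≢′ → f≗0 (suc l) (l≢ ∘ suc-injective) (l≢′ ∘ suc-injective)) cancel)

  -- Deleting a column outside an adjacent pair leaves the pair adjacent, now at positions `k′` and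
  -- `k′ + 1` of the minor.
  punchIn-adjacent : (l : Fin (suc (suc n))) (k : Fin (suc n)) → l ≢ inject₁ k → l ≢ suc k →
                     ∃[ k′ ] punchIn l (inject₁ k′) ≡ inject₁ k × punchIn l (suc k′) ≡ suc k
  punchIn-adjacent zero zero l≢ l≢′ = contradiction refl l≢
  punchIn-adjacent zero (suc k) l≢ l≢′ = k , refl , refl
  punchIn-adjacent (suc zero) zero l≢ l≢′ = contradiction refl l≢′
  punchIn-adjacent {suc n} (suc (suc l)) zero l≢ l≢′ = zero , refl , refl
  punchIn-adjacent {suc n} (suc l) (suc k) l≢ l≢′
    with k′ , eq , eq′ ← punchIn-adjacent l k (l≢ ∘ cong suc) (l≢′ ∘ cong suc)
    = suc k′ , cong suc eq , cong suc eq′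

  -- Deleting either member of an adjacent pair leaves the same columns in the same places, except
  -- that one place holds the surviving member of the pair.
  punchIn-inject₁-suc : (k j : Fin n) →
                        (punchIn (inject₁ k) j ≡ suc k × punchIn (suc k) j ≡ inject₁ k) ⊎ punchIn (inject₁ k) j ≡ punchIn (suc k) j
  punchIn-inject₁-suc zero    zero    = inj₁ (refl , refl)
  punchIn-inject₁-suc zero    (suc j) = inj₂ refl
  punchIn-inject₁-suc (suc k) zero    = inj₂ refl
  punchIn-inject₁-suc (suc k) (suc j) =
    Sum.map (Product.map (cong suc) (cong suc)) (cong suc) (punchIn-inject₁-suc k j)

  -- In the Laplace expansion, a term outside the pair has a minor that again contains two equal
  -- adjacent columns, so it vanishes by induction. The two remaining terms have equal entries,
  -- equal minors and opposite signs.
  det-adjacent : (A : Matrix (suc n)) (k : Fin n) → (∀ i → A i (inject₁ k) ≡ A i (suc k)) → det A ≡ 0ℤ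
  det-adjacent {suc n} A k Aₖ = sum-adjacent-cancel _ k other cancel
    where
    other : ∀ l → l ≢ inject₁ k → l ≢ suc k → -1ℤ ^ toℕ l * A zero l * det (minor l A) ≡ 0ℤ
    other l l≢ l≢′ with k′ , eq , eq′ ← punchIn-adjacent l k l≢ l≢′ =
      trans (cong (-1ℤ ^ toℕ l * A zero l *_) (det-adjacent (minor l A) k′ λ i →
              trans (cong (A (suc i)) eq) (trans (Aₖ (suc i)) (cong (A (suc i)) (sym eq′)))))
            (*-zeroʳ (-1ℤ ^ toℕ l * A zero l))

    minors : det (minor (inject₁ k) A) ≡ det (minor (suc k) A)
    minors = det-cong λ i j → entries i (punchIn-inject₁-suc k j)
      where
      entries : ∀ i {a b} → (a ≡ suc k × b ≡ inject₁ k) ⊎ a ≡ b → A (suc i) a ≡ A (suc i) b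
      entries i (inj₁ (refl , refl)) = sym (Aₖ (suc i))
      entries i (inj₂ refl) = refl

    opposite : ∀ s a d → s * a * d + -1ℤ * s * a * d ≡ 0ℤ
    opposite = solve-∀

    cancel : -1ℤ ^ toℕ (inject₁ k) * A zero (inject₁ k) * det (minor (inject₁ k) A)
           + -1ℤ ^ toℕ (suc k) * A zero (suc k) * det (minor (suc k) A) ≡ 0ℤ
    cancel = trans
      (cong₂ _+_
        (trans (cong₂ (λ s d → s * A zero (inject₁ k) * d) (cong (-1ℤ ^_) (toℕ-inject₁ k)) minors)
               (cong (λ a → -1ℤ ^ toℕ k * a * det (minor (suc k) A)) (Aₖ zero)))
        refl)
      (opposite (-1ℤ ^ toℕ k) (A zero (suc k)) (det (minor (suc k) A)))

  -- Column replacement and equal columns at any distance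

  infix 8 _[_≔_]
  _[_≔_] : Matrix n → Fin n → Vector ℤ n → Matrix n
  (A [ k ≔ v ]) i = updateAt (A i) k (const (v i))

  ≔-updates : (A : Matrix n) (k : Fin n) (v : Vector ℤ n) → ∀ i → (A [ k ≔ v ]) i k ≡ v i
  ≔-updates A k v i = updateAt-updates k (A i)

  ≔-minimal : (A : Matrix n) (k : Fin n) (v : Vector ℤ n) → AgreeOff k (A [ k ≔ v ]) A
  ≔-minimal A k v i j j≢k = updateAt-minimal j k (A i) j≢k

  ≔-agree : (A : Matrix n) (k : Fin n) (v w : Vector ℤ n) → AgreeOff k (A [ k ≔ v ]) (A [ k ≔ w ])
  ≔-agree A k v w i j j≢k = trans (≔-minimal A k v i j j≢k) (sym (≔-minimal A k w i j j≢k))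

  ≔-self : (A : Matrix n) (k : Fin n) → ∀ i j → (A [ k ≔ (λ i → A i k) ]) i j ≡ A i j
  ≔-self A k i = updateAt-id-local k (A i) refl

  ≔-cong : (A : Matrix n) (k : Fin n) {v w : Vector ℤ n} → (∀ i → v i ≡ w i) →
           det (A [ k ≔ v ]) ≡ det (A [ k ≔ w ])
  ≔-cong A k {v} {w} v≗w = det-cong λ i j → cong (λ x → updateAt (A i) k (const x) j) (v≗w i)

  det-≔-linear : (A : Matrix n) (k : Fin n) (x : ℤ) (v w : Vector ℤ n) →
                 det (A [ k ≔ (λ i → v i + x * w i) ]) ≡ det (A [ k ≔ v ]) + x * det (A [ k ≔ w ])
  det-≔-linear A k x v w = det-linear (A [ k ≔ v+xw ]) (A [ k ≔ v ]) (A [ k ≔ w ]) k x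
    (λ i → trans (≔-updates A k v+xw i)
      (sym (cong₂ (λ a b → a + x * b) (≔-updates A k v i) (≔-updates A k w i))))
    (≔-agree A k v+xw v) (≔-agree A k v+xw w)
    where v+xw = λ i → v i + x * w i

  -- Induction on the right-hand column `b`: exchanging it with its left neighbour changes only the
  -- sign of the determinant and brings the equal columns closer, until they are adjacent.
  det-equal-< : (b : Fin (suc n)) (A : Matrix (suc n)) (a : Fin (suc n)) → a <ᶠ b →
                (∀ i → A i a ≡ A i b) → det A ≡ 0ℤ
  det-equal-< {n} = <-weakInduction _ (λ _ _ ()) step
    where
    step : (k : Fin n) →
           ((A : Matrix (suc n)) (a : Fin (suc n)) → a <ᶠ inject₁ k →
            (∀ i → A i a ≡ A i (inject₁ k)) → det A ≡ 0ℤ) →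
           (A : Matrix (suc n)) (a : Fin (suc n)) → a <ᶠ suc k → (∀ i → A i a ≡ A i (suc k)) → det A ≡ 0ℤ
    step k ih A a a<b Aₐ with a ≟ inject₁ k
    ... | yes refl = det-adjacent A k Aₐ
    -- The exchange is done by linearity. Writing [x, y] for the determinant with columns x, y at
    -- `k₀`, `k₁`: [u, w] = [u+w, w] = [u+w, u+w] - [u+w, u] = -[u, u] - [w, u]. Here [w, u]
    -- vanishes by `ih`, because column `a` of the matrix is `w`.
    ... | no a≢k = begin
      det A                                ≡⟨ +-identityʳ (det A) ⟨
      det A + 1ℤ * 0ℤ                      ≡⟨ cong (λ d → det A + 1ℤ * d) det-ww ⟨
      det A + 1ℤ * det (A [ k₀ ≔ w ])      ≡⟨ det-linear B A (A [ k₀ ≔ w ]) k₀ 1ℤ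
        (λ i → trans (≔-updates A k₀ u+w i) (cong (λ x → u i + 1ℤ * x) (sym (≔-updates A k₀ w i))))
        (≔-minimal A k₀ u+w) (≔-agree A k₀ u+w w) ⟨
      det B                                ≡⟨ det-linear B B₁ B₂ k₁ -1ℤ
        (λ i → trans (≔-minimal A k₀ u+w i k₁ k₁≢k₀)
          (trans (difference (u i) (w i))
            (cong₂ (λ x y → x + -1ℤ * y) (sym (≔-updates B k₁ u+w i)) (sym (≔-updates B k₁ u i)))))
        (λ i j j≢ → sym (≔-minimal B k₁ u+w i j j≢)) (λ i j j≢ → sym (≔-minimal B k₁ u i j j≢)) ⟩
      det B₁ + -1ℤ * det B₂                ≡⟨ cong₂ (λ x y → x + -1ℤ * y) det-B₁ det-B₂ ⟩
      0ℤ ∎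
      where
      k₀ k₁ : Fin (suc n)
      k₀ = inject₁ k
      k₁ = suc k

      u w u+w : Vector ℤ (suc n)
      u i = A i k₀
      w i = A i k₁
      u+w i = u i + 1ℤ * w i

      B B₁ B₂ : Matrix (suc n)
      B  = A [ k₀ ≔ u+w ]
      B₁ = B [ k₁ ≔ u+w ]
      B₂ = B [ k₁ ≔ u ]

      difference : ∀ x y → y ≡ x + 1ℤ * y + -1ℤ * x
      difference = solve-∀

      k₁≢k₀ : k₁ ≢ k₀
      k₁≢k₀ eq = ℕ.1+n≢n (trans (cong toℕ eq) (toℕ-inject₁ k))

      a<k₀ : a <ᶠ k₀
      a<k₀ = ℕ.≤∧≢⇒< (subst (toℕ a ℕ.≤_) (sym (toℕ-inject₁ k)) (s≤s⁻¹ a<b)) (a≢k ∘ toℕ-injective)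

      a≢k₁ : a ≢ k₁
      a≢k₁ refl = ℕ.<-irrefl refl a<b

      det-ww : det (A [ k₀ ≔ w ]) ≡ 0ℤ
      det-ww = det-adjacent (A [ k₀ ≔ w ]) k λ i →
        trans (≔-updates A k₀ w i) (sym (≔-minimal A k₀ w i k₁ k₁≢k₀))

      det-B₁ : det B₁ ≡ 0ℤ
      det-B₁ = det-adjacent B₁ k λ i →
        trans (≔-minimal B k₁ u+w i k₀ (k₁≢k₀ ∘ sym))
          (trans (≔-updates A k₀ u+w i) (sym (≔-updates B k₁ u+w i)))

      B₂-k₁ : ∀ i → B₂ i k₁ ≡ u i
      B₂-k₁ = ≔-updates B k₁ u

      det-B₂ : det B₂ ≡ 0ℤ
      det-B₂ = begin
        det B₂ ≡⟨ det-linear B₂ (B₂ [ k₀ ≔ u ]) (B₂ [ k₀ ≔ w ]) k₀ 1ℤ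
          (λ i → trans (≔-minimal B k₁ u i k₀ (k₁≢k₀ ∘ sym)) (trans (≔-updates A k₀ u+w i)
            (sym (cong₂ (λ x y → x + 1ℤ * y) (≔-updates B₂ k₀ u i) (≔-updates B₂ k₀ w i)))))
          (λ i j j≢ → sym (≔-minimal B₂ k₀ u i j j≢)) (λ i j j≢ → sym (≔-minimal B₂ k₀ w i j j≢)) ⟩
        det (B₂ [ k₀ ≔ u ]) + 1ℤ * det (B₂ [ k₀ ≔ w ]) ≡⟨ cong₂ (λ x y → x + 1ℤ * y)
          (det-adjacent (B₂ [ k₀ ≔ u ]) k λ i → trans (≔-updates B₂ k₀ u i)
            (sym (trans (≔-minimal B₂ k₀ u i k₁ k₁≢k₀) (B₂-k₁ i))))
          (ih (B₂ [ k₀ ≔ w ]) a a<k₀ λ i → trans (≔-minimal B₂ k₀ w i a a≢k)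
            (trans (≔-minimal B k₁ u i a a≢k₁)
              (trans (≔-minimal A k₀ u+w i a a≢k)
                (trans (Aₐ i) (sym (≔-updates B₂ k₀ w i)))))) ⟩
        0ℤ ∎

  det-equal : (A : Matrix n) (a b : Fin n) → a ≢ b → (∀ i → A i a ≡ A i b) → det A ≡ 0ℤ
  det-equal {suc n} A a b a≢b Aₐ with <-cmp a b
  ... | tri< a<b _ _ = det-equal-< b A a a<b Aₐ
  ... | tri≈ _ a≡b _ = contradiction a≡b a≢b
  ... | tri> _ _ b<a = det-equal-< a A b b<a (sym ∘ Aₐ)

  -- Cramer's rule and divisibility

  det-≔-sum : ∀ {m} (A : Matrix n) (k : Fin n) (y : Vector ℤ m) (V : Fin n → Vector ℤ m) →
              det (A [ k ≔ (λ i → sum (λ j → y j * V i j)) ]) ≡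
              sum (λ j → y j * det (A [ k ≔ (λ i → V i j) ]))
  -- The zero column is 0 + (-1) · 0, so linearity makes its determinant a difference of two equal
  -- numbers.
  det-≔-sum {m = zero} A k y V = trans (det-≔-linear A k -1ℤ (λ _ → 0ℤ) (λ _ → 0ℤ))
    (opposite (det (A [ k ≔ (λ _ → 0ℤ) ])))
    where
    opposite : ∀ d → d + -1ℤ * d ≡ 0ℤ
    opposite = solve-∀
  det-≔-sum {m = suc m} A k y V = begin
    det (A [ k ≔ (λ i → y zero * V i zero + rest i) ])
      ≡⟨ ≔-cong A k (λ i → +-comm (y zero * V i zero) (rest i)) ⟩
    det (A [ k ≔ (λ i → rest i + y zero * V i zero) ])
      ≡⟨ det-≔-linear A k (y zero) rest (λ i → V i zero) ⟩
    det (A [ k ≔ rest ]) + y zero * det (A [ k ≔ (λ i → V i zero) ])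
      ≡⟨ +-comm (det (A [ k ≔ rest ])) _ ⟩
    y zero * det (A [ k ≔ (λ i → V i zero) ]) + det (A [ k ≔ rest ])
      ≡⟨ cong (λ s → y zero * det (A [ k ≔ (λ i → V i zero) ]) + s)
           (det-≔-sum A k (y ∘ suc) (λ i → V i ∘ suc)) ⟩
    sum (λ j → y j * det (A [ k ≔ (λ i → V i j) ])) ∎
    where rest = λ i → sum (λ j → y (suc j) * V i (suc j))

  -- By linearity the left side is a sum over the columns `j`; every term with `j ≢ k` has column
  -- `j` twice and vanishes.
  cramer : (A : Matrix n) (y : Vector ℤ n) (k : Fin n) →
           det (A [ k ≔ (λ i → sum (λ j → y j * A i j)) ]) ≡ y k * det A
  cramer {suc n} A y k = begin
    det (A [ k ≔ (λ i → sum (λ j → y j * A i j)) ])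
      ≡⟨ det-≔-sum A k y A ⟩
    sum t
      ≡⟨ sum-remove {i = k} t ⟩
    y k * det (A [ k ≔ (λ i → A i k) ]) + sum (λ j → t (punchIn k j))
      ≡⟨ cong₂ (λ d s → y k * d + s) (det-cong (≔-self A k))
           (trans (sum-cong-≗ λ j → repeated (punchIn k j) (punchInᵢ≢i k j)) (sum-replicate-zero n)) ⟩
    y k * det A + 0ℤ
      ≡⟨ +-identityʳ _ ⟩
    y k * det A ∎
    where
    t : Vector ℤ (suc n)
    t j = y j * det (A [ k ≔ (λ i → A i j) ])

    repeated : ∀ j → j ≢ k → t j ≡ 0ℤ
    repeated j j≢k = trans
      (cong (y j *_) (det-equal (A [ k ≔ (λ i → A i j) ]) j k j≢k λ i →
        trans (≔-minimal A k (λ i → A i j) i j j≢k) (sym (≔-updates A k (λ i → A i j) i))))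
      (*-zeroʳ (y j))

  sum-∣ : ∀ {m} (f : Vector ℤ n) → (∀ i → m ∣ f i) → m ∣ sum f
  sum-∣ {zero}  f m∣f = divides 0ℤ refl
  sum-∣ {suc n} f m∣f = ∣m∣n⇒∣m+n (m∣f zero) (sum-∣ (f ∘ suc) (m∣f ∘ suc))

  -- Each Laplace term contains the column `k`: through its entry when the expansion column is `k`,
  -- through its minor otherwise.
  det-∣-column : ∀ {m} (A : Matrix n) (k : Fin n) → (∀ i → m ∣ A i k) → m ∣ det A
  det-∣-column {suc n} {m} A k m∣Aₖ = sum-∣ _ term
    where
    term : ∀ l → m ∣ -1ℤ ^ toℕ l * A zero l * det (minor l A)
    term l with l ≟ k
    ... | yes refl = ∣m⇒∣m*n (det (minor l A)) (∣n⇒∣m*n (-1ℤ ^ toℕ l) (m∣Aₖ zero))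
    ... | no l≢k = ∣n⇒∣m*n (-1ℤ ^ toℕ l * A zero l) (det-∣-column (minor l A) (punchOut l≢k) λ i →
      subst (λ j → m ∣ A (suc i) j) (sym (punchIn-punchOut l≢k)) (m∣Aₖ (suc i)))

-- Arithmetic modulo n

-- A record, because [mod_] unfolds to a divisibility of a difference, from
-- which Agda cannot recover the two sides.
infix 4 _≈_[mod_]
record _≈_[mod_] (a b : ℤ) (m : ℕ) : Set where
  constructor congruent
  field modulus∣difference : a ≡ b [mod m ]
open _≈_[mod_]

mod-reflexive : a ≡ b → a ≈ b [mod m ]
mod-reflexive a≡b = congruent (divides 0ℤ (i≡j⇒i-j≡0 a≡b))

mod-sym : a ≈ b [mod m ] → b ≈ a [mod m ]
mod-sym {a} {b} {m} (congruent p) = congruent (subst (+ m ∣_) (flip a b) (∣m⇒∣-m p))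
  where
  flip : ∀ x y → - (x - y) ≡ y - x
  flip = solve-∀

mod-trans : ∀ {c} → a ≈ b [mod m ] → b ≈ c [mod m ] → a ≈ c [mod m ]
mod-trans {a} {b} {m} {c} (congruent p) (congruent q) =
  congruent (subst (+ m ∣_) (telescope a b c) (∣m∣n⇒∣m+n p q))
  where
  telescope : ∀ x y z → (x - y) + (y - z) ≡ x - z
  telescope = solve-∀

modSetoid : ℕ → Setoid _ _
modSetoid m = record
  { Carrier = ℤ
  ; _≈_ = _≈_[mod m ]
  ; isEquivalence = record { refl = mod-reflexive refl ; sym = mod-sym ; trans = mod-trans }
  }

+-mod : a ≈ b [mod m ] → a′ ≈ b′ [mod m ] → a + a′ ≈ b + b′ [mod m ]
+-mod {a} {b} {m} {a′} {b′} (congruent p) (congruent q) =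
  congruent (subst (+ m ∣_) (regroup a b a′ b′) (∣m∣n⇒∣m+n p q))
  where
  regroup : ∀ x y z w → (x - y) + (z - w) ≡ (x + z) - (y + w)
  regroup = solve-∀

*-mod : a ≈ b [mod m ] → a′ ≈ b′ [mod m ] → a * a′ ≈ b * b′ [mod m ]
*-mod {a} {b} {m} {a′} {b′} (congruent p) (congruent q) =
  congruent (subst (+ m ∣_) (regroup a b a′ b′) (∣m∣n⇒∣m+n (∣m⇒∣m*n a′ p) (∣n⇒∣m*n b q)))
  where
  regroup : ∀ x y z w → (x - y) * z + y * (z - w) ≡ x * z - y * w
  regroup = solve-∀

*-modˡ : ∀ c → a ≈ b [mod m ] → c * a ≈ c * b [mod m ]
*-modˡ c = *-mod {c} {c} (mod-reflexive refl)

*-modʳ : ∀ c → a ≈ b [mod m ] → a * c ≈ b * c [mod m ]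
*-modʳ c p = *-mod p (mod-reflexive {c} {c} refl)

^-mod : ∀ e → a ≈ b [mod m ] → a ^ e ≈ b ^ e [mod m ]
^-mod zero    p = mod-reflexive refl
^-mod (suc e) p = *-mod p (^-mod e p)

sum-mod : (f g : Vector ℤ n) → (∀ i → f i ≈ g i [mod m ]) → sum f ≈ sum g [mod m ]
sum-mod {zero}  f g f~g = mod-reflexive refl
sum-mod {suc n} f g f~g = +-mod (f~g zero) (sum-mod (f ∘ suc) (g ∘ suc) (f~g ∘ suc))

product-mod : (f g : Vector ℤ n) → (∀ i → f i ≈ g i [mod m ]) → product f ≈ product g [mod m ]
product-mod {zero}  f g f~g = mod-reflexive refl
product-mod {suc n} f g f~g = *-mod (f~g zero) (product-mod (f ∘ suc) (g ∘ suc) (f~g ∘ suc))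

^-distribʳ-* : ∀ x y e → (x * y) ^ e ≡ x ^ e * y ^ e
^-distribʳ-* x y zero    = refl
^-distribʳ-* x y (suc e) = trans (cong (x * y *_) (^-distribʳ-* x y e)) (regroup x y (x ^ e) (y ^ e))
  where
  regroup : ∀ x y u v → x * y * (u * v) ≡ x * u * (y * v)
  regroup = solve-∀

residue : ∀ n .{{_ : NonZero n}} → ℤ → Fin n
residue n z = fromℕ< (n%ℕd<d z n)

residue-mod : ∀ n .{{_ : NonZero n}} z → + toℕ (residue n z) ≈ z [mod n ]
residue-mod n z = congruent (divides (- (z /ℕ n)) (trans
  (cong₂ (λ r w → + r - w) (toℕ-fromℕ< (n%ℕd<d z n)) (a≡a%ℕn+[a/ℕn]*n z n))
  (cancel (+ (z %ℕ n)) (z /ℕ n) (+ n))))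
  where
  cancel : ∀ r q k → r - (r + q * k) ≡ - q * k
  cancel = solve-∀

-- The difference of two indices is a multiple of `n` of absolute value less than `n`, hence zero.
toℕ-mod-injective : (i j : Fin n) → + toℕ i ≈ + toℕ j [mod n ] → i ≡ j
toℕ-mod-injective {n} i j (congruent i~j) = toℕ-injective (+-injective (i-j≡0⇒i≡j (+ toℕ i) (+ toℕ j)
  (∣i∣≡0⇒i≡0 (small (∣⇒∣ᵤ i~j) ∣i-j∣<n))))
  where
  ∣i-j∣<n : abs (+ toℕ i - + toℕ j) ℕ.< n
  ∣i-j∣<n = ℕ.≤-<-trans
    (subst (ℕ._≤ toℕ i ℕ.⊔ toℕ j) (cong abs (sym (m-n≡m⊖n (toℕ i) (toℕ j)))) (∣m⊝n∣≤m⊔n (toℕ i) (toℕ j)))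
    (ℕ.⊔-lub (toℕ<n i) (toℕ<n j))

  small : ∀ {k} → n ℕ.∣ k → k ℕ.< n → k ≡ 0
  small {zero}  n∣k k<n = refl
  small {suc k} n∣k k<n = contradiction n∣k (ℕ.>⇒∤ k<n)

-- Multiplication by a unit as a permutation of the residues

scale : ∀ n .{{_ : NonZero n}} → ℤ → Fin n → Fin n
scale n a i = residue n (a * + toℕ i)

scale-inverse : ∀ n .{{_ : NonZero n}} a b → a * b ≈ 1ℤ [mod n ] → ∀ i → scale n a (scale n b i) ≡ i
scale-inverse n a b ab~1 i = toℕ-mod-injective _ i (begin
  + toℕ (scale n a (scale n b i))  ≈⟨ residue-mod n (a * + toℕ (scale n b i)) ⟩
  a * + toℕ (scale n b i)          ≈⟨ *-modˡ a (residue-mod n (b * + toℕ i)) ⟩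
  a * (b * + toℕ i)                ≡⟨ *-assoc a b (+ toℕ i) ⟨
  a * b * + toℕ i                  ≈⟨ *-modʳ (+ toℕ i) ab~1 ⟩
  1ℤ * + toℕ i                     ≡⟨ *-identityˡ (+ toℕ i) ⟩
  + toℕ i                          ∎)
  where open SetoidReasoning (modSetoid n)

scale-zero : ∀ n c → scale (suc n) c zero ≡ zero
scale-zero n c = toℕ-mod-injective (scale (suc n) c zero) zero
  (mod-trans (residue-mod (suc n) (c * 0ℤ)) (mod-reflexive (*-zeroʳ c)))

scalePermutation : ∀ n .{{_ : NonZero n}} a b → a * b ≈ 1ℤ [mod n ] → Permutation′ n
scalePermutation n a b ab~1 = permutation (scale n a) (scale n b) (scale-inverse n a b ab~1)
  (scale-inverse n b a (subst (_≈ 1ℤ [mod n ]) (*-comm a b) ab~1))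

-- Multiplication by the unit `a` only permutes the summands. The permuted index is the residue of
-- `a * j`, so `g` has to respect congruence for the residue to be replaced by the product itself.
sum-scale : ∀ n .{{_ : NonZero n}} a b → a * b ≈ 1ℤ [mod n ] → (g : ℤ → ℤ) →
            (∀ {x y} → x ≈ y [mod n ] → g x ≈ g y [mod n ]) →
            sum {n} (λ j → g (+ toℕ j)) ≈ sum {n} (λ j → g (a * + toℕ j)) [mod n ]
sum-scale n a b ab~1 g g-mod = begin
  sum {n} (λ j → g (+ toℕ j))              ≡⟨ sum-permute (λ j → g (+ toℕ j)) (scalePermutation n a b ab~1) ⟩
  sum {n} (λ j → g (+ toℕ (scale n a j)))  ≈⟨ sum-mod (λ j → g (+ toℕ (scale n a j)))
    (λ j → g (a * + toℕ j)) (λ j → g-mod (residue-mod n (a * + toℕ j))) ⟩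
  sum {n} (λ j → g (a * + toℕ j))          ∎
  where open SetoidReasoning (modSetoid n)

-- Inverses and cancellation modulo a prime

module _ {p : ℕ} (p-prime : Prime p) where

  inverse : ∀ k .{{_ : NonZero k}} → k ℕ.< p → ∃[ b ] + k * b ≈ 1ℤ [mod p ]
  inverse k k<p with coprime-Bézout (prime⇒coprime p-prime k<p)
  -- Bézout's identity in ℕ has two sign patterns: 1 + yk = xp gives the inverse -y, and 1 + xp = yk
  -- gives y.
  ... | Bézout.+- x y 1+yk≡xp = - (+ y) , congruent (divides (- (+ x)) (trans (regroup (+ k) (+ y))
        (trans (cong -_ lifted) (neg (+ x) (+ p)))))
    where
    regroup : ∀ u v → u * (- v) - 1ℤ ≡ - (1ℤ + v * u)
    regroup = solve-∀
    neg : ∀ u v → - (u * v) ≡ - u * v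
    neg = solve-∀
    lifted : 1ℤ + + y * + k ≡ + x * + p
    lifted = trans (cong (λ z → 1ℤ + z) (sym (pos-* y k))) (trans (cong +_ 1+yk≡xp) (pos-* x p))
  ... | Bézout.-+ x y 1+xp≡yk = + y , congruent (divides (+ x) (trans
        (cong (_- 1ℤ) (trans (*-comm (+ k) (+ y)) (sym lifted)))
        (regroup (+ x * + p))))
    where
    regroup : ∀ u → 1ℤ + u - 1ℤ ≡ u
    regroup = solve-∀
    lifted : 1ℤ + + x * + p ≡ + y * + k
    lifted = trans (cong (λ z → 1ℤ + z) (sym (pos-* x p))) (trans (cong +_ 1+xp≡yk) (pos-* y k))

  euclid : ∀ x y → + p ∣ x * y → + p ∣ x ⊎ + p ∣ y
  euclid x y p∣xy = Sum.map ∣ᵤ⇒∣ ∣ᵤ⇒∣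
    (euclidsLemma (abs x) (abs y) p-prime (subst (p ℕ.∣_) (abs-* x y) (∣⇒∣ᵤ p∣xy)))

  ∤-small : ∀ k .{{_ : NonZero k}} → k ℕ.< p → ¬ + p ∣ + k
  ∤-small k k<p p∣k = ℕ.>⇒∤ k<p (∣⇒∣ᵤ p∣k)

  ∤1 : ¬ + p ∣ 1ℤ
  ∤1 = ∤-small 1 (ℕ.nonTrivial⇒n>1 p {{prime⇒nonTrivial p-prime}})

  product-∤ : (f : Vector ℤ n) → (∀ i → ¬ + p ∣ f i) → ¬ + p ∣ product f
  product-∤ {zero}  f p∤f p∣1 = ∤1 p∣1
  product-∤ {suc n} f p∤f p∣∏ with euclid (f zero) (product (f ∘ suc)) p∣∏
  ... | inj₁ p∣f₀ = p∤f zero p∣f₀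
  ... | inj₂ p∣∏′ = product-∤ (f ∘ suc) (p∤f ∘ suc) p∣∏′

  *-mod-cancelʳ : ∀ x → ¬ + p ∣ x → a * x ≈ b * x [mod p ] → a ≈ b [mod p ]
  *-mod-cancelʳ {a} {b} x p∤x (congruent ax~bx) with euclid (a - b) x (subst (+ p ∣_) (factor a b x) ax~bx)
    where
    factor : ∀ u v w → u * w - v * w ≡ (u - v) * w
    factor = solve-∀
  ... | inj₁ a~b = congruent a~b
  ... | inj₂ p∣x = contradiction p∣x p∤x

-- Fermat's little theorem and power sums

product-const : ∀ n x → product {n} (const x) ≡ x ^ n
product-const zero    x = refl
product-const (suc n) x = cong (x *_) (product-const n x)

-- Multiplication by `k` permutes the nonzero residues, so their product is congruent to `k ^ n`
-- times itself; it is prime to the modulus and cancels.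
fermat : Prime (suc n) → ∀ k .{{_ : NonZero k}} → k ℕ.< suc n → (+ k) ^ n ≈ 1ℤ [mod suc n ]
fermat {n} p-prime k k<p with b , kb~1 ← inverse p-prime k k<p =
  *-mod-cancelʳ p-prime (product u) (product-∤ p-prime u p∤u) (begin
  (+ k) ^ n * product u             ≡⟨ cong (_* product u) product-w ⟨
  product w * product u             ≡⟨ ∏-distrib-* w u ⟨
  product (λ i → w i * u i)         ≈⟨ product-mod (λ i → u (π ⟨$⟩ʳ i)) (λ i → w i * u i) u-scale ⟨
  product (λ i → u (π ⟨$⟩ʳ i))      ≡⟨ product-permute u π ⟨
  product u                         ≡⟨ *-identityˡ (product u) ⟨
  1ℤ * product u                    ∎)
  where
  open SetoidReasoning (modSetoid (suc n))

  π : Permutation′ (suc n)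
  π = scalePermutation (suc n) (+ k) b kb~1

  -- Index 0 carries the factor 1, so that the products run over the nonzero residues.
  u w : Vector ℤ (suc n)
  u zero    = 1ℤ
  u (suc i) = + suc (toℕ i)
  w zero    = 1ℤ
  w (suc i) = + k

  product-w : product w ≡ (+ k) ^ n
  product-w = trans (*-identityˡ (product {n} (const (+ k)))) (product-const n (+ k))

  p∤u : ∀ i → ¬ + suc n ∣ u i
  p∤u zero    = ∤1 p-prime
  p∤u (suc i) = ∤-small p-prime (suc (toℕ i)) (toℕ<n (suc i))

  u-scale : ∀ i → u (scale (suc n) (+ k) i) ≈ w i * u i [mod suc n ]
  u-scale i with scale (suc n) (+ k) i in eq
  u-scale zero    | zero   = mod-reflexive refl
  -- Scaling by the inverse `b` would send 0 back to the nonzero index `suc i`, yet scaling fixes 0.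
  u-scale (suc i) | zero   = contradiction
    (trans (sym (scale-zero n b)) (trans (sym (cong (scale (suc n) b) eq))
      (scale-inverse (suc n) b (+ k) (subst (_≈ 1ℤ [mod suc n ]) (*-comm (+ k) b) kb~1) (suc i))))
    λ ()
  u-scale zero    | suc j  = contradiction (trans (sym eq) (scale-zero n (+ k))) λ ()
  u-scale (suc i) | suc j  = subst (λ z → + toℕ z ≈ + k * + suc (toℕ i) [mod suc n ]) eq
    (residue-mod (suc n) (+ k * + suc (toℕ i)))

-- Multiplying all residues by `k` permutes them and multiplies the sum S by `k ^ e`, so `k ^ e` · S
-- ≡ S. If p did not divide S, cancelling S would give `k ^ e` ≡ 1.
power-sum : ∀ {p} → Prime p → ∀ k .{{_ : NonZero k}} → k ℕ.< p → ∀ e → ¬ (+ k) ^ e ≈ 1ℤ [mod p ] →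
            sum {p} (λ j → (+ toℕ j) ^ e) ≈ 0ℤ [mod p ]
power-sum {p@(suc _)} p-prime k k<p e kᵉ≁1 with b , kb~1 ← inverse p-prime k k<p
  with (+ p) ∣? sum {p} (λ j → (+ toℕ j) ^ e)
... | yes p∣S = congruent (subst (+ p ∣_) (sym (+-identityʳ (sum {p} (λ j → (+ toℕ j) ^ e)))) p∣S)
... | no p∤S = contradiction (*-mod-cancelʳ p-prime S p∤S (begin
    (+ k) ^ e * S                                    ≡⟨ *-distribˡ-sum ((+ k) ^ e) power ⟩
    sum {p} (λ j → (+ k) ^ e * (+ toℕ j) ^ e)        ≡⟨ sum-cong-≗ {p} (λ j → ^-distribʳ-* (+ k) (+ toℕ j) e) ⟨
    sum {p} (λ j → (+ k * + toℕ j) ^ e)              ≈⟨ sum-scale p (+ k) b kb~1 (_^ e) (^-mod e) ⟨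
    S                                                ≡⟨ *-identityˡ S ⟨
    1ℤ * S                                           ∎)) kᵉ≁1
  where
  open SetoidReasoning (modSetoid p)
  power : Vector ℤ p
  power j = (+ toℕ j) ^ e
  S = sum power

-- The matrix of the theorem

quadratic : (c d x y : ℤ) → ℤ
quadratic c d x y = x ^ 2 + c * x * y + d * y ^ 2

quadratic-mod : ∀ c d x {y z} → y ≈ z [mod m ] → quadratic c d x y ≈ quadratic c d x z [mod m ]
quadratic-mod c d x y~z =
  +-mod (+-mod (mod-reflexive {x ^ 2} refl) (*-modˡ (c * x) y~z)) (*-modˡ d (^-mod 2 y~z))

quadratic-homogeneous : ∀ c d x t → quadratic c d x (x * t) ≡ x ^ 2 * quadratic c d 1ℤ t
quadratic-homogeneous = expanded
  where
  -- The powers are unfolded to products, an equality by computation, so that the ring solver meets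
  -- only sums and products.
  expanded : ∀ c d x t → x * (x * 1ℤ) + c * x * (x * t) + d * (x * t * (x * t * 1ℤ)) ≡
             x * (x * 1ℤ) * (1ℤ + c * 1ℤ * t + d * (t * (t * 1ℤ)))
  expanded = solve-∀

quadratic-0ˡ : ∀ c d y → quadratic c d 0ℤ y ≡ d * y ^ 2
quadratic-0ˡ = expanded
  where
  expanded : ∀ c d y → 0ℤ + c * 0ℤ * y + d * (y * (y * 1ℤ)) ≡ d * (y * (y * 1ℤ))
  expanded = solve-∀

quadratic-0ʳ : ∀ c d x → quadratic c d x 0ℤ ≡ x ^ 2
quadratic-0ʳ = expanded
  where
  expanded : ∀ c d x → x * (x * 1ℤ) + c * x * 0ℤ + d * 0ℤ ≡ x * (x * 1ℤ)
  expanded = solve-∀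

-- The prime is written `2 + e`, so that the exponent p - 2 of the theorem is `e` itself. That `e`
-- is nonzero gives 0 ^ e = 0 in the corner entry.
module _ (c d : ℤ) (e : ℕ) .{{_ : NonZero e}}
         (p-prime : Prime (2 ℕ.+ e)) (3<p : 3 ℕ.< 2 ℕ.+ e) where

  p : ℕ
  p = 2 ℕ.+ e

  open SetoidReasoning (modSetoid p)

  entries : Matrix p
  entries i j = quadratic c d (+ toℕ i) (+ toℕ j) ^ e

  -- The constant C of the overview.
  rowSum₁ : ℤ
  rowSum₁ = sum {p} (λ t → quadratic c d 1ℤ (+ toℕ t) ^ e)

  -- By Fermat 4 · 4^(p-2) = (2^(p-1))² ≡ 1, so 4^(p-2) ≡ 1 would force p ∣ 3.
  4^[p-2]≉1 : ¬ (+ 2) ^ (2 ℕ.* e) ≈ 1ℤ [mod p ]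
  4^[p-2]≉1 4ᵉ~1 = ∤-small p-prime 3 3<p (modulus∣difference (begin
    + 4                         ≈⟨ *-modˡ (+ 4) 4ᵉ~1 ⟨
    + 4 * (+ 2) ^ (2 ℕ.* e)     ≡⟨ cong (+ 4 *_) (^-*-assoc (+ 2) 2 e) ⟨
    + 4 * (+ 4) ^ e             ≡⟨ ^-distribʳ-* (+ 2) (+ 2) (suc e) ⟩
    (+ 2) ^ suc e * (+ 2) ^ suc e ≈⟨ *-mod fermat₂ fermat₂ ⟩
    1ℤ * 1ℤ                     ∎))
    where
    fermat₂ : (+ 2) ^ suc e ≈ 1ℤ [mod p ]
    fermat₂ = fermat p-prime 2 (ℕ.<-trans (ℕ.n<1+n 2) 3<p)

  -- Row 0 is separate because its index has no inverse modulo p; both sides vanish there, and this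
  -- is where p > 3 enters, through `4^[p-2]≉1`. In any other row the substitution of `x * t` for
  -- the column index and homogeneity take out the factor `(x ^ 2) ^ e`, which is the entry in
  -- column 0.
  row-sum : ∀ i → sum (entries i) ≈ rowSum₁ * entries i zero [mod p ]
  row-sum zero = begin
    sum (entries zero)
      ≡⟨ sum-cong-≗ {p} (λ j → trans (cong (_^ e) (quadratic-0ˡ c d (+ toℕ j)))
           (trans (^-distribʳ-* d ((+ toℕ j) ^ 2) e) (cong (d ^ e *_) (^-*-assoc (+ toℕ j) 2 e)))) ⟩
    sum {p} (λ j → d ^ e * (+ toℕ j) ^ (2 ℕ.* e))
      ≡⟨ *-distribˡ-sum {p} (d ^ e) (λ j → (+ toℕ j) ^ (2 ℕ.* e)) ⟨
    d ^ e * sum {p} (λ j → (+ toℕ j) ^ (2 ℕ.* e))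
      ≈⟨ *-modˡ (d ^ e) (power-sum p-prime 2 (ℕ.<-trans (ℕ.n<1+n 2) 3<p) (2 ℕ.* e) 4^[p-2]≉1) ⟩
    d ^ e * 0ℤ            ≡⟨ *-zeroʳ (d ^ e) ⟩
    0ℤ                    ≡⟨ *-zeroʳ rowSum₁ ⟨
    rowSum₁ * 0ℤ          ≡⟨ cong (rowSum₁ *_) (0^ e) ⟨
    rowSum₁ * 0ℤ ^ e      ≡⟨ cong (λ z → rowSum₁ * z ^ e) (quadratic-0ʳ c d 0ℤ) ⟨
    rowSum₁ * entries zero zero ∎
    where
    0^ : ∀ k .{{_ : NonZero k}} → 0ℤ ^ k ≡ 0ℤ
    0^ (suc k) = refl
  row-sum i@(suc k) with b , ib~1 ← inverse p-prime (toℕ i) (toℕ<n i) = begin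
    sum (entries i)
      ≈⟨ sum-scale p x b ib~1 (λ y → quadratic c d x y ^ e) (λ y~z → ^-mod e (quadratic-mod c d x y~z)) ⟩
    sum {p} (λ t → quadratic c d x (x * + toℕ t) ^ e)
      ≡⟨ sum-cong-≗ {p} (λ t → trans (cong (_^ e) (quadratic-homogeneous c d x (+ toℕ t)))
           (^-distribʳ-* (x ^ 2) (quadratic c d 1ℤ (+ toℕ t)) e)) ⟩
    sum {p} (λ t → (x ^ 2) ^ e * quadratic c d 1ℤ (+ toℕ t) ^ e)
      ≡⟨ *-distribˡ-sum {p} ((x ^ 2) ^ e) (λ t → quadratic c d 1ℤ (+ toℕ t) ^ e) ⟨
    (x ^ 2) ^ e * rowSum₁     ≡⟨ *-comm ((x ^ 2) ^ e) rowSum₁ ⟩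
    rowSum₁ * (x ^ 2) ^ e     ≡⟨ cong (λ z → rowSum₁ * z ^ e) (quadratic-0ʳ c d x) ⟨
    rowSum₁ * entries i zero  ∎
    where
    x : ℤ
    x = + toℕ i

  -- The coefficients of "sum of all columns minus C times column 0".
  relation : Vector ℤ p
  relation zero    = 1ℤ - rowSum₁
  relation (suc j) = 1ℤ

  entries-relation : ∀ i → + p ∣ sum (λ j → relation j * entries i j)
  entries-relation i = subst (+ p ∣_) (sym weighted) (modulus∣difference (row-sum i))
    where
    regroup : ∀ x r s → (1ℤ - r) * x + s ≡ x + s - r * x
    regroup = solve-∀

    weighted : sum (λ j → relation j * entries i j) ≡ sum (entries i) - rowSum₁ * entries i zero
    weighted = trans
      (cong (λ s → relation zero * entries i zero + s) (sum-cong-≗ λ j → *-identityˡ (entries i (suc j))))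
      (regroup (entries i zero) rowSum₁ (sum (entries i ∘ suc)))

  -- Putting the combination given by `relation` into column `k` multiplies the determinant by
  -- `relation k`, and the new column is divisible by p.
  p∣det-entries : + p ∣ det entries
  p∣det-entries = subst (+ p ∣_) (trans (cramer entries relation k) (*-identityˡ (det entries)))
    (det-∣-column (entries [ k ≔ combination ]) k λ i →
      subst (+ p ∣_) (sym (≔-updates entries k combination i)) (entries-relation i))
    where
    k : Fin p
    -- Column 1 has coefficient exactly 1, whereas the coefficient 1 - C of column 0 could be
    -- divisible by p.
    k = suc zero

    combination : Vector ℤ p
    combination i = sum (λ j → relation j * entries i j)

theorem1p6 : (c d : ℤ) (p : ℕ) → Prime p → 3 < p →
    det {p} (λ i j → ((+ toℕ i) ^ 2 + c * (+ toℕ i) * (+ toℕ j) + d * (+ toℕ j) ^ 2) ^ (p ∸ 2)) ≡ 0ℤ [mod p ]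
-- This pattern makes `p ∸ 2` reduce to `e`. The congruence to 0 unfolds to divisibility of the
-- determinant minus 0, which accounts for `+-identityʳ`.
theorem1p6 c d p@(suc (suc e@(suc _))) p-prime 3<p =
  subst (+ p ∣_) (sym (+-identityʳ (det (entries c d e p-prime 3<p)))) (p∣det-entries c d e p-prime 3<p)
theorem1p6 c d 1 p-prime (s≤s ())
theorem1p6 c d 2 p-prime (s≤s (s≤s ()))
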